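{- Let $r_1,r_2$ be positive integers. Then $\psi_{d,\min}(M_{r_1,r_2}(K_2))=2$ if and only if $r_1\ge 2$ and $r_2\ge 2$. Moreover, if $r_1,r_2\ge 2$ then there is a homomorphism $M_{r_1,r_2}(K_2)\to S_4$, while for all positive integers $r$ and $m$ there is no homomorphism $M_{1,r}(K_2)\to S_m$ and no homomorphism $M_{r,1}(K_2)\to S_m$.
   Context: For a graph $G$ and positive integer $r$, the generalized Mycielskian $M_r(G)$ has vertex set $\{(v,i):v\in V(G),0\le i\le r-1\}\cup\{z\}$, with $(u,i)$ adjacent to $(v,j)$ iff $\{u,v\}\in E(G)$ and ($|i-j|=1$ or $i=j=0$), and $z$ adjacent to all $(v,r-1)$, $v\in V(G)$. $M_{r_1,r_2}(G)=M_{r_2}(M_{r_1}(G))$. For a digraph $D$, $N_+[v]=\{v\}\cup\{u:(v,u)\in E(D)\}$, $c(U)=\{c(u):u\in U\}$, and $\psi_d(D)=\min_c\max_v|c(N_+[v])|$ over proper colorings $c$ of the underlying graph; $\psi_{d,\min}(G)$ is the minimum of $\psi_d(\vec G)$ over all orientations $\vec G$ of $G$. The symmetric shift graph $S_m$ has vertex set $\{(i,j):1\le i,j\le m,\ i\ne j\}$, and $(i,j)$ is adjacent to $(k,\ell)$ iff $j=k$ or $i=\ell$. -}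

module Defs where

open import Data.Empty using (⊥; ⊥-elim-irr)
open import Data.Fin using (Fin; toℕ)
open import Data.List using (List; length)
open import Data.List.Membership.Propositional using (_∈_)
open import Data.List.Relation.Unary.Unique.Propositional using (Unique)
open import Data.Nat using (ℕ; suc; _≤_; ∣_-_∣)
open import Data.Nat.Properties using (∣-∣-comm)
open import Data.Product using (∃; _×_; _,_; proj₁; swap)
open import Data.Sum using (_⊎_; inj₁; inj₂; [_,_]′) renaming (swap to ⊎-swap; map to ⊎-map)
open import Function using (_∘_; _⇔_)
open import Level using (Level; 0ℓ) renaming (suc to lsuc)
open import Relation.Binary using (Rel; Symmetric)
open import Relation.Binary.PropositionalEquality using (_≡_; _≢_; refl; sym; trans; ≢-sym)
open import Relation.Nullary using (¬_)
open import Relation.Unary using (Pred)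

record Graph : Set₁ where
  field
    V       : Set
    Adj     : Rel V 0ℓ
    adj-sym : Symmetric Adj
    no-loop : ∀ {v} → ¬ Adj v v

open Graph public

Hom : Graph → Graph → Set
Hom G H = ∃ λ (f : V G → V H) → ∀ u v → Adj G u v → Adj H (f u) (f v)

K : ℕ → Graph
K n = record
  { V       = Fin n
  ; Adj     = _≢_
  ; adj-sym = ≢-sym
  ; no-loop = λ v≢v → v≢v refl
  }

data MycVertex (A : Set) (r : ℕ) : Set where
  lvl : A → Fin r → MycVertex A r
  z   : MycVertex A r

module _ (r : ℕ) (G : Graph) where

  -- `suc (toℕ i) ≡ r` says that i is the top level r - 1.
  MycAdj : Rel (MycVertex (V G) r) 0ℓ
  MycAdj (lvl u i) (lvl v j) =
    Adj G u v × (∣ toℕ i - toℕ j ∣ ≡ 1 ⊎ (toℕ i ≡ 0 × toℕ j ≡ 0))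
  MycAdj (lvl _ i) z         = suc (toℕ i) ≡ r
  MycAdj z         (lvl _ i) = suc (toℕ i) ≡ r
  MycAdj z         z         = ⊥

  private
    MycAdj-sym : Symmetric MycAdj
    MycAdj-sym {lvl u i} {lvl v j} (e , l) =
      adj-sym G e , ⊎-map (trans (∣-∣-comm (toℕ j) (toℕ i))) swap l
    MycAdj-sym {lvl _ _} {z}       p = p
    MycAdj-sym {z}       {lvl _ _} p = p

    MycAdj-no-loop : ∀ {x} → ¬ MycAdj x x
    MycAdj-no-loop {lvl _ _} (e , _) = no-loop G e

  -- The generalized Mycielskian M_r(G), intended for r ≥ 1.
  M : Graph
  M = record
    { V       = MycVertex (V G) r
    ; Adj     = MycAdj
    ; adj-sym = λ {x} {y} → MycAdj-sym {x} {y}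
    ; no-loop = λ {x} → MycAdj-no-loop {x}
    }

M₂ : ℕ → ℕ → Graph → Graph
M₂ r₁ r₂ G = M r₂ (M r₁ G)

record ShiftVertex (m : ℕ) : Set where
  constructor pair
  field
    fst       : Fin m
    snd       : Fin m
    .distinct : fst ≢ snd

open ShiftVertex public

ShiftAdj : (m : ℕ) → Rel (ShiftVertex m) 0ℓ
ShiftAdj m x y = snd x ≡ fst y ⊎ fst x ≡ snd y

private
  ShiftAdj-no-loop : ∀ m {x} → ¬ ShiftAdj m x x
  ShiftAdj-no-loop m {pair _ _ i≢j} (inj₁ j≡i) = ⊥-elim-irr (i≢j (sym j≡i))
  ShiftAdj-no-loop m {pair _ _ i≢j} (inj₂ i≡j) = ⊥-elim-irr (i≢j i≡j)

-- The symmetric shift graph S_m, with the indices 1, …, m represented by Fin m.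
S : ℕ → Graph
S m = record
  { V       = ShiftVertex m
  ; Adj     = ShiftAdj m
  ; adj-sym = [ inj₂ ∘ sym , inj₁ ∘ sym ]′
  ; no-loop = λ {x} → ShiftAdj-no-loop m {x}
  }

record Digraph : Set₁ where
  field
    DV          : Set
    Arc         : Rel DV 0ℓ
    arc-no-loop : ∀ {v} → ¬ Arc v v

open Digraph public

underlying : Digraph → Graph
underlying D = record
  { V       = DV D
  ; Adj     = λ u v → Arc D u v ⊎ Arc D v u
  ; adj-sym = ⊎-swap
  ; no-loop = [ arc-no-loop D , arc-no-loop D ]′
  }

record Orientation (G : Graph) : Set₁ where
  field
    arc      : Rel (V G) 0ℓ
    arc⇒adj  : ∀ u v → arc u v → Adj G u v
    adj⇒arc  : ∀ u v → Adj G u v → arc u v ⊎ arc v u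
    one-way  : ∀ u v → arc u v → ¬ arc v u

  digraph : Digraph
  digraph = record
    { DV          = V G
    ; Arc         = arc
    ; arc-no-loop = λ {v} a → one-way v v a a
    }

ProperColoring : Graph → Set
ProperColoring G = ∃ λ (c : V G → ℕ) → ∀ u v → Adj G u v → c u ≢ c v

private variable
  ℓ : Level

IsLeast : Pred ℕ ℓ → Pred ℕ ℓ
IsLeast P k = P k × (∀ n → P n → k ≤ n)

IsGreatest : Pred ℕ ℓ → Pred ℕ ℓ
IsGreatest P k = P k × (∀ n → P n → n ≤ k)

HasCardinality : Pred ℕ ℓ → Pred ℕ ℓ
HasCardinality P k =
  ∃ λ (xs : List ℕ) → Unique xs × (∀ x → x ∈ xs ⇔ P x) × length xs ≡ k

N₊ : (D : Digraph) → DV D → Pred (DV D) 0ℓ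
N₊ D v u = u ≡ v ⊎ Arc D v u

Image : {A : Set} → (A → ℕ) → Pred A 0ℓ → Pred ℕ 0ℓ
Image c U x = ∃ λ u → U u × c u ≡ x

-- Cardinalities, minima and maxima are relations "the value is k", since
-- Set-valued adjacency does not compute.  For finite nonempty graphs
-- exactly one k satisfies each of the following three predicates.

-- max_v |c(N₊[v])| = k
MaxColors[_,_]≡_ : (D : Digraph) → (DV D → ℕ) → Pred ℕ 0ℓ
MaxColors[ D , c ]≡ k =
  IsGreatest (λ n → ∃ λ v → HasCardinality (Image c (N₊ D v)) n) k

-- ψ_d(D) = k
ψd[_]≡_ : Digraph → Pred ℕ 0ℓ
ψd[ D ]≡ k =
  IsLeast (λ n → ∃ λ (c : ProperColoring (underlying D)) → MaxColors[ D , proj₁ c ]≡ n) k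

-- ψ_{d,min}(G) = k
ψd-min[_]≡_ : Graph → Pred ℕ (lsuc 0ℓ)
ψd-min[ G ]≡ k =
  IsLeast (λ n → ∃ λ (O : Orientation G) → ψd[ Orientation.digraph O ]≡ n) k

{-# OPTIONS --safe #-}
-- Both ψ_{d,min}(G) = 2 and a homomorphism G → S_m give an orientation of G
-- with a proper coloring in which the out-neighbours of each vertex share one
-- color; call this an out-coloring (a vertex of S_m is the pair formed by its
-- own color and the color of its out-neighbours).
--
-- In M_1(G) the apex z splits the rest into its in- and its out-neighbours.
-- Out-neighbours of z share a color, and an in-neighbour of z has no other
-- out-neighbour since that would have the color of z; so G is bipartite, which
-- the odd cycle M_r(K_2) is not.  In M_r(K_3) the bottom triangle is
-- cyclically oriented, and each level is forced to repeat the colors and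
-- out-colors of the level below; then z must point to three distinct colors.
--
-- In the positive direction, collapsing the two lowest levels maps M_{r+1}(G) to
-- M_r(G), so the only case needed is the Grötzsch graph M_{2,2}(K_2) → S_4.
module Submission where

open import Data.Bool using (Bool; true; false)
open import Data.Bool.Properties using (¬-not)
open import Data.Empty using (⊥; ⊥-elim)
open import Data.Fin using (Fin; zero; suc; toℕ; fromℕ; inject₁; #_)
import Data.Fin as Fin
import Data.Fin.Properties as Fin
open import Data.Fin.Induction using (<-weakInduction)
open import Data.List using (List; []; _∷_; length; lookup; map; filter; deduplicate; allFin; cartesianProductWith)
open import Data.List.Membership.Propositional using (_∈_)
open import Data.List.Membership.Propositional.Properties using (∈-lookup; ∈-map⁺; ∈-map⁻; ∈-filter⁺; ∈-filter⁻; ∈-deduplicate⁺; ∈-deduplicate⁻; ∈-allFin; ∈-cartesianProductWith⁺)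
import Data.List.Membership.Setoid.Properties as Membership
open import Data.List.Relation.Binary.Subset.Propositional using (_⊆_)
open import Data.List.Relation.Unary.All using ([]; _∷_; all?) renaming (lookup to All-lookup)
open import Data.List.Relation.Unary.AllPairs using ([]; _∷_)
open import Data.List.Relation.Unary.Any using (here; there; index)
open import Data.List.Relation.Unary.Unique.DecPropositional.Properties using (deduplicate-!)
open import Data.List.Relation.Unary.Unique.Propositional using (Unique)
open import Data.Nat using (ℕ; zero; suc; _≤_; s≤s; z≤n; _≟_; ∣_-_∣)
open import Data.Nat.Properties using (≤-trans; suc-injective)
open import Data.Product using (∃; _×_; _,_; proj₁; proj₂)
open import Data.Sum using (_⊎_; inj₁; inj₂; [_,_]′; swap)
open import Function using (_∘_; _⇔_; mk⇔; Injective; Equivalence; id; case_of_)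
open import Relation.Binary using (Decidable; tri<; tri≈; tri>)
open import Relation.Binary.PropositionalEquality using (_≡_; _≢_; refl; sym; trans; cong; setoid; ≢-sym)
open import Relation.Nullary using (¬_; yes; no; contradiction)
open import Relation.Nullary.Decidable using (¬?; _×-dec_; _⊎-dec_; _→-dec_; from-yes; recompute)
open import Defs

-- Counting with duplicate-free lists

lookup-injective : {A : Set} {xs : List A} → Unique xs → Injective _≡_ _≡_ (lookup xs)
lookup-injective (_ ∷ _)  {zero}  {zero}  _  = refl
lookup-injective (p ∷ _)  {zero}  {suc j} eq = contradiction eq (All-lookup p (∈-lookup j))
lookup-injective (p ∷ _)  {suc i} {zero}  eq = contradiction (sym eq) (All-lookup p (∈-lookup i))
lookup-injective (_ ∷ ps) {suc i} {suc j} eq = cong suc (lookup-injective ps eq)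

-- Sending a position in `xs` to the position of the same entry in `ys` is an injection between
-- finite index sets.
unique-⊆⇒length≤ : {A : Set} {xs ys : List A} → Unique xs → xs ⊆ ys → length xs ≤ length ys
unique-⊆⇒length≤ {A} uxs xs⊆ys = Fin.injective⇒≤ {f = λ i → index (xs⊆ys (∈-lookup i))}
  λ eq → lookup-injective uxs (Membership.index-injective (setoid A) _ _ eq)

-- Out-colorings and shift graphs

record OutColoring (G : Graph) : Set₁ where
  field
    orientation : Orientation G
  open Orientation orientation public
  field
    color     : V G → ℕ
    proper    : ∀ {u v} → Adj G u v → color u ≢ color v
    out-color : ∀ {u v w} → arc u v → arc u w → color v ≡ color w

  proper-arc : ∀ {u v} → arc u v → color u ≢ color v
  proper-arc a = proper (arc⇒adj _ _ a)

open OutColoring using (orientation; color; proper; out-color; arc; proper-arc)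

-- The field `distinct` is irrelevant; decidable equality on `Fin m` recovers a usable proof.
fst≢snd : ∀ {m} (x : ShiftVertex m) → fst x ≢ snd x
fst≢snd (pair i j i≢j) = recompute (¬? (i Fin.≟ j)) i≢j

-- x → y when y continues x; two opposite pairs continue each other, and then
-- the smaller first coordinate is the tail.
ShiftArc : ∀ {m} → ShiftVertex m → ShiftVertex m → Set
ShiftArc x y = snd x ≡ fst y × (fst x ≡ snd y → fst x Fin.< fst y)

shiftArc-total : ∀ {m} (x y : ShiftVertex m) → snd x ≡ fst y → ShiftArc x y ⊎ ShiftArc y x
shiftArc-total x y p with fst x Fin.≟ snd y
... | no ¬q = inj₁ (p , ⊥-elim ∘ ¬q)
... | yes q with Fin.<-cmp (fst x) (fst y)
...   | tri< lt _ _ = inj₁ (p , λ _ → lt)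
...   | tri≈ _ eq _ = contradiction (trans eq (sym p)) (fst≢snd x)
...   | tri> _ _ gt = inj₂ (sym q , λ _ → gt)

-- The color is the first coordinate, so every out-neighbour of `x` has color `snd x`.
shiftOutColoring : ∀ m → OutColoring (S m)
shiftOutColoring m = record
  { orientation = record
    { arc     = ShiftArc
    ; arc⇒adj = λ _ _ → inj₁ ∘ proj₁
    ; adj⇒arc = λ x y → [ shiftArc-total x y , swap ∘ shiftArc-total y x ∘ sym ]′
    ; one-way = λ { x y (p , x<y) (q , y<x) → Fin.<-asym (x<y (sym q)) (y<x (sym p)) }
    }
  ; color     = toℕ ∘ fst
  ; proper    = λ {x} {y} → λ
    { (inj₁ p) eq → fst≢snd x (trans (Fin.toℕ-injective eq) (sym p))
    ; (inj₂ p) eq → fst≢snd y (trans (sym (Fin.toℕ-injective eq)) p) }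
  ; out-color = λ a b → cong toℕ (trans (sym (proj₁ a)) (proj₁ b))
  }

pullback : ∀ {G H} → Hom G H → OutColoring H → OutColoring G
pullback {G} (f , hom) C = record
  { orientation = record
    -- Adjacency is imposed because a homomorphism may send non-adjacent vertices to the ends of an
    -- arc.
    { arc     = λ u v → Adj G u v × C.arc (f u) (f v)
    ; arc⇒adj = λ _ _ → proj₁
    ; adj⇒arc = λ u v e → case C.adj⇒arc _ _ (hom u v e) of λ
      { (inj₁ a) → inj₁ (e , a)
      ; (inj₂ a) → inj₂ (adj-sym G e , a) }
    ; one-way = λ u v a b → C.one-way _ _ (proj₂ a) (proj₂ b)
    }
  ; color     = C.color ∘ f
  ; proper    = λ e → C.proper (hom _ _ e)
  ; out-color = λ a b → C.out-color (proj₂ a) (proj₂ b)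
  }
  where module C = OutColoring C

shift-hom⇒outColoring : ∀ {G m} → Hom G (S m) → OutColoring G
shift-hom⇒outColoring h = pullback h (shiftOutColoring _)

-- The value 2 and out-colorings on finite graphs

record Finite (G : Graph) : Set where
  field
    vertices : List (V G)
    complete : ∀ v → v ∈ vertices
    adj?     : Decidable (Adj G)

module _ {G : Graph} (fin : Finite G) (O : Orientation G) where
  open Finite fin
  open Orientation O using (adj⇒arc; arc⇒adj; digraph) renaming (arc to _⟶_; one-way to asym)

  -- For an edge, `adj⇒arc` already picks a direction, and `asym` excludes the other one.
  arc? : Decidable _⟶_
  arc? u v with adj? u v
  ... | no ¬e = no (¬e ∘ arc⇒adj u v)
  ... | yes e with adj⇒arc u v e
  ...   | inj₁ a = yes a
  ...   | inj₂ a = no (asym v u a)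

  -- `MaxColors` bounds a vertex only through a known cardinality, so one has to be produced at
  -- every vertex.
  image-hasCardinality : ∀ (c : V G → ℕ) v → ∃ (HasCardinality (Image c (N₊ digraph v)))
  image-hasCardinality c v =
    length xs , xs , deduplicate-! _≟_ ys , (λ x → mk⇔ (to ∘ ∈-deduplicate⁻ _≟_ ys) (∈-deduplicate⁺ _≟_ ∘ from)) , refl
    where
    ys xs : List ℕ
    ys = c v ∷ map c (filter (arc? v) vertices)
    xs = deduplicate _≟_ ys

    to : ∀ {x} → x ∈ ys → Image c (N₊ digraph v) x
    to (here refl) = v , inj₁ refl , refl
    to (there p) with ∈-map⁻ c p
    ... | u , u∈ , refl = u , inj₂ (proj₂ (∈-filter⁻ (arc? v) {xs = vertices} u∈)) , refl

    from : ∀ {x} → Image c (N₊ digraph v) x → x ∈ ys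
    from (u , inj₁ refl , refl) = here refl
    from (u , inj₂ a    , refl) = there (∈-map⁺ c (∈-filter⁺ (arc? v) (complete u) a))

  maxColors-bound : ∀ {c n v zs} → MaxColors[ digraph , c ]≡ n →
    Unique zs → (∀ {x} → x ∈ zs → Image c (N₊ digraph v) x) → length zs ≤ n
  maxColors-bound {c} {v = v} (_ , max) uzs zs⊆ with image-hasCardinality c v
  ... | k , xs , uxs , iff , refl =
    ≤-trans (unique-⊆⇒length≤ uzs (λ {x} → Equivalence.from (iff x) ∘ zs⊆)) (max k (v , xs , uxs , iff , refl))

  arc⇒2≤maxColors : ∀ {u v n} → u ⟶ v →
    (c : ProperColoring (underlying digraph)) → MaxColors[ digraph , proj₁ c ]≡ n → 2 ≤ n
  arc⇒2≤maxColors {u} {v} a (c , prop) max = maxColors-bound max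
    ((prop u v (inj₁ a) ∷ []) ∷ [] ∷ [])
    λ { (here refl) → u , inj₁ refl , refl ; (there (here refl)) → v , inj₂ a , refl }

  adj⇒2≤ψd : ∀ {u v n} → Adj G u v → ψd[ digraph ]≡ n → 2 ≤ n
  adj⇒2≤ψd {u} {v} e ((c , max) , _) with adj⇒arc u v e
  ... | inj₁ a = arc⇒2≤maxColors a c max
  ... | inj₂ a = arc⇒2≤maxColors a c max

  -- Two out-neighbours of different colors, together with their common tail, would put three colors
  -- in one closed out-neighbourhood.
  maxColors≡2⇒outColoring : (c : ProperColoring (underlying digraph)) →
    MaxColors[ digraph , proj₁ c ]≡ 2 → OutColoring G
  maxColors≡2⇒outColoring (c , prop) max = record
    { orientation = O
    ; color       = c
    ; proper      = λ {u} {v} e → prop u v (adj⇒arc u v e)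
    ; out-color   = same
    }
    where
    same : ∀ {u v w} → u ⟶ v → u ⟶ w → c v ≡ c w
    same {u} {v} {w} a b with c v ≟ c w
    ... | yes eq  = eq
    ... | no v≢w = contradiction
      (maxColors-bound max
        ((prop u v (inj₁ a) ∷ prop u w (inj₁ b) ∷ []) ∷ (v≢w ∷ []) ∷ [] ∷ [])
        λ { (here refl) → u , inj₁ refl , refl
          ; (there (here refl)) → v , inj₂ a , refl
          ; (there (there (here refl))) → w , inj₂ b , refl })
      λ { (s≤s (s≤s ())) }

ψd-min≡2⇒outColoring : ∀ {G} → Finite G → ψd-min[ G ]≡ 2 → OutColoring G
ψd-min≡2⇒outColoring fin ((O , (c , max) , _) , _) = maxColors≡2⇒outColoring fin O c max

module _ {G : Graph} (C : OutColoring G) where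
  open OutColoring C using (digraph) renaming (arc to _⟶_; color to c)

  outColoring⇒maxColors≡2 : ∀ {u v} → u ⟶ v → MaxColors[ digraph , c ]≡ 2
  outColoring⇒maxColors≡2 {u} {v} a =
    (u , (c u ∷ c v ∷ []) , (proper-arc C a ∷ []) ∷ [] ∷ [] , (λ x → mk⇔ to from) , refl) , bound
    where
    to : ∀ {x} → x ∈ c u ∷ c v ∷ [] → Image c (N₊ digraph u) x
    to (here refl)         = u , inj₁ refl , refl
    to (there (here refl)) = v , inj₂ a , refl

    from : ∀ {x} → Image c (N₊ digraph u) x → x ∈ c u ∷ c v ∷ []
    from (_ , inj₁ refl , refl) = here refl
    from (_ , inj₂ b    , refl) = there (here (out-color C b a))

    -- Three distinct colors in N₊[w] include two other than c w.
    bound : ∀ n → ∃ (λ w → HasCardinality (Image c (N₊ digraph w)) n) → n ≤ 2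
    bound _ (_ , []          , _ , _ , refl) = z≤n
    bound _ (_ , _ ∷ []      , _ , _ , refl) = s≤s z≤n
    bound _ (_ , _ ∷ _ ∷ []  , _ , _ , refl) = s≤s (s≤s z≤n)
    bound _ (w , x ∷ y ∷ t ∷ _ , ((x≢y ∷ x≢t ∷ _) ∷ (y≢t ∷ _) ∷ _) , iff , _)
      with Equivalence.to (iff x) (here refl)
         | Equivalence.to (iff y) (there (here refl))
         | Equivalence.to (iff t) (there (there (here refl)))
    ... | _ , inj₁ refl , refl | _ , inj₁ refl , refl | _                    = contradiction refl x≢y
    ... | _ , inj₁ refl , refl | _                    | _ , inj₁ refl , refl = contradiction refl x≢t
    ... | _                    | _ , inj₁ refl , refl | _ , inj₁ refl , refl = contradiction refl y≢t
    ... | _ , inj₂ a    , refl | _ , inj₂ b    , refl | _                    = contradiction (out-color C a b) x≢y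
    ... | _ , inj₂ a    , refl | _                    | _ , inj₂ b    , refl = contradiction (out-color C a b) x≢t
    ... | _                    | _ , inj₂ a    , refl | _ , inj₂ b    , refl = contradiction (out-color C a b) y≢t

-- The edge does double duty: it makes the out-coloring attain 2, and it forces at least 2 colors at
-- its tail in any orientation and coloring.
outColoring⇒ψd-min≡2 : ∀ {G u v} → Finite G → Adj G u v → OutColoring G → ψd-min[ G ]≡ 2
outColoring⇒ψd-min≡2 {G} {u} {v} fin e C =
  (orientation C , (coloring , max) , λ { n (c , m) → 2≤ c m }) , λ { n (O , ψ) → adj⇒2≤ψd fin O e ψ }
  where
  coloring : ProperColoring (underlying (OutColoring.digraph C))
  coloring = color C , λ _ _ → [ proper-arc C , (λ a → ≢-sym (proper-arc C a)) ]′

  max : MaxColors[ OutColoring.digraph C , color C ]≡ 2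
  max = [ outColoring⇒maxColors≡2 C , outColoring⇒maxColors≡2 C ]′ (OutColoring.adj⇒arc C u v e)

  2≤ : ∀ {n} (c : ProperColoring (underlying (OutColoring.digraph C))) →
    MaxColors[ OutColoring.digraph C , proj₁ c ]≡ n → 2 ≤ n
  2≤ c m with OutColoring.adj⇒arc C u v e
  ... | inj₁ a = arc⇒2≤maxColors fin (orientation C) a c m
  ... | inj₂ a = arc⇒2≤maxColors fin (orientation C) a c m

-- Finiteness of the Mycielskians

K-finite : ∀ n → Finite (K n)
K-finite n = record
  { vertices = allFin n
  ; complete = ∈-allFin
  ; adj?     = λ u v → ¬? (u Fin.≟ v)
  }

M-finite : ∀ {G} r → Finite G → Finite (M r G)
M-finite {G} r fin = record
  { vertices = z ∷ cartesianProductWith lvl vertices (allFin r)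
  ; complete = λ { z → here refl ; (lvl v i) → there (∈-cartesianProductWith⁺ lvl (complete v) (∈-allFin i)) }
  ; adj?     = λ
    { (lvl u i) (lvl v j) →
        adj? u v ×-dec ((∣ toℕ i - toℕ j ∣ ≟ 1) ⊎-dec ((toℕ i ≟ 0) ×-dec (toℕ j ≟ 0)))
    ; (lvl _ i) z → suc (toℕ i) ≟ r
    ; z (lvl _ i) → suc (toℕ i) ≟ r
    ; z z → no id }
  }
  where open Finite fin

M₂-finite : ∀ r₁ r₂ → Finite (M₂ r₁ r₂ (K 2))
M₂-finite r₁ r₂ = M-finite r₂ (M-finite r₁ (K-finite 2))

-- Homomorphisms between Mycielskians and into `S 4`

M-map : ∀ {G H} r → Hom G H → Hom (M r G) (M r H)
M-map {G} {H} r (f , hom) = g , g-hom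
  where
  g : V (M r G) → V (M r H)
  g (lvl v i) = lvl (f v) i
  g z         = z

  g-hom : ∀ u v → Adj (M r G) u v → Adj (M r H) (g u) (g v)
  g-hom (lvl u _) (lvl v _) (e , l) = hom u v e , l
  g-hom (lvl _ _) z         e       = e
  g-hom z         (lvl _ _) e       = e

M-collapse : ∀ {G} n → Hom (M (suc (suc n)) G) (M (suc n) G)
M-collapse {G} n = g , g-hom
  where
  down : Fin (suc (suc n)) → Fin (suc n)
  down zero    = zero
  down (suc i) = i

  g : V (M (suc (suc n)) G) → V (M (suc n) G)
  g (lvl v i) = lvl v (down i)
  g z         = z

  down-top : ∀ i → suc (toℕ i) ≡ suc (suc n) → suc (toℕ (down i)) ≡ suc n
  down-top zero    ()
  down-top (suc i) p = suc-injective p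

  g-hom : ∀ u v → Adj (M (suc (suc n)) G) u v → Adj (M (suc n) G) (g u) (g v)
  g-hom (lvl _ zero)    (lvl _ zero)    (e , _)      = e , inj₂ (refl , refl)
  -- Edges between the two merged levels land in the copy of `G` on level 0.
  g-hom (lvl _ zero)    (lvl _ (suc j)) (e , inj₁ p) = e , inj₂ (refl , suc-injective p)
  g-hom (lvl _ (suc i)) (lvl _ zero)    (e , inj₁ p) = e , inj₂ (suc-injective p , refl)
  g-hom (lvl _ (suc i)) (lvl _ (suc j)) (e , inj₁ p) = e , inj₁ p
  g-hom (lvl _ i)       z               p            = down-top i p
  g-hom z               (lvl _ i)       p            = down-top i p

Hom-∘ : ∀ G H I → Hom H I → Hom G H → Hom G I
Hom-∘ _ _ _ (g , g-hom) (f , f-hom) = g ∘ f , λ u v e → g-hom _ _ (f-hom u v e)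

M-collapse-to-2 : ∀ G r → 2 ≤ r → Hom (M r G) (M 2 G)
M-collapse-to-2 _ (suc zero)          (s≤s ())
M-collapse-to-2 _ (suc (suc zero))    _ = id , λ _ _ e → e
M-collapse-to-2 G (suc (suc (suc n))) _ =
  Hom-∘ (M (suc (suc (suc n))) G) (M (suc (suc n)) G) (M 2 G)
    (M-collapse-to-2 G (suc (suc n)) (s≤s (s≤s z≤n))) (M-collapse (suc n))

-- Found by computer search.
grötzsch→S₄ : Hom (M₂ 2 2 (K 2)) (S 4)
grötzsch→S₄ = f , λ u v → All-lookup (All-lookup checked (complete u)) (complete v)
  where
  open Finite (M₂-finite 2 2)

  f : V (M₂ 2 2 (K 2)) → ShiftVertex 4
  f (lvl (lvl zero zero) zero)                   = pair (# 0) (# 1) λ ()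
  f (lvl (lvl zero (suc zero)) zero)             = pair (# 0) (# 2) λ ()
  f (lvl (lvl (suc zero) zero) zero)             = pair (# 1) (# 0) λ ()
  f (lvl (lvl (suc zero) (suc zero)) zero)       = pair (# 1) (# 2) λ ()
  f (lvl z zero)                                 = pair (# 2) (# 3) λ ()
  f (lvl (lvl zero zero) (suc zero))             = pair (# 0) (# 1) λ ()
  f (lvl (lvl zero (suc zero)) (suc zero))       = pair (# 3) (# 1) λ ()
  f (lvl (lvl (suc zero) zero) (suc zero))       = pair (# 3) (# 0) λ ()
  f (lvl (lvl (suc zero) (suc zero)) (suc zero)) = pair (# 3) (# 0) λ ()
  f (lvl z (suc zero))                           = pair (# 2) (# 1) λ ()
  f z                                            = pair (# 1) (# 3) λ ()

  shiftAdj? : Decidable (ShiftAdj 4)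
  shiftAdj? x y = (snd x Fin.≟ fst y) ⊎-dec (fst x Fin.≟ snd y)

  -- All pairs of the 11 vertices are checked by evaluating the decision procedure.
  checked = from-yes (all? (λ u → all? (λ v → adj? u v →-dec shiftAdj? (f u) (f v)) vertices) vertices)

-- The outer construction is collapsed first; the inner collapse is then carried through `M 2` by
-- functoriality.
M₂→S₄ : ∀ r₁ r₂ → 2 ≤ r₁ → 2 ≤ r₂ → Hom (M₂ r₁ r₂ (K 2)) (S 4)
M₂→S₄ r₁ r₂ 2≤r₁ 2≤r₂ =
  Hom-∘ (M₂ r₁ r₂ (K 2)) (M₂ 2 2 (K 2)) (S 4) grötzsch→S₄
  (Hom-∘ (M₂ r₁ r₂ (K 2)) (M₂ r₁ 2 (K 2)) (M₂ 2 2 (K 2))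
    (M-map 2 (M-collapse-to-2 (K 2) r₁ 2≤r₁)) (M-collapse-to-2 (M r₁ (K 2)) r₂ 2≤r₂))

-- Bipartiteness and the outer index 1

∣n-1+n∣≡1 : ∀ n → ∣ n - suc n ∣ ≡ 1
∣n-1+n∣≡1 zero    = refl
∣n-1+n∣≡1 (suc n) = ∣n-1+n∣≡1 n

module _ (G : Graph) {r : ℕ} where

  level-adj : ∀ {u v} (i : Fin r) → Adj G u v → Adj (M (suc r) G) (lvl u (inject₁ i)) (lvl v (suc i))
  level-adj i e = e , inj₁ (trans (cong (λ k → ∣ k - suc (toℕ i) ∣) (Fin.toℕ-inject₁ i)) (∣n-1+n∣≡1 (toℕ i)))

  top-adj : ∀ v → Adj (M (suc r) G) (lvl v (fromℕ r)) z
  top-adj _ = cong suc (Fin.toℕ-fromℕ r)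

Bool-no-triangle : ∀ {a b c : Bool} → a ≢ b → a ≢ c → b ≢ c → ⊥
Bool-no-triangle a≢b a≢c b≢c = b≢c (trans (¬-not (≢-sym a≢b)) (sym (¬-not (≢-sym a≢c))))

M-K₂-not-bipartite : ∀ r (f : V (M (suc r) (K 2)) → Bool) →
  ¬ (∀ u v → Adj (M (suc r) (K 2)) u v → f u ≢ f v)
M-K₂-not-bipartite r f proper =
  Bool-no-triangle (level-proper (fromℕ r)) (proper _ z (top-adj (K 2) (# 0))) (proper _ z (top-adj (K 2) (# 1)))
  where
  level-proper : ∀ i → f (lvl (# 0) i) ≢ f (lvl (# 1) i)
  -- If the two vertices of level `i + 1` agreed, their common value would differ from both values
  -- on level `i`, which are already distinct.
  level-proper = <-weakInduction _ (proper _ _ ((λ ()) , inj₂ (refl , refl))) λ i ih eq →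
    Bool-no-triangle ih
      (proper _ _ (level-adj (K 2) i λ ()))
      (λ eq′ → proper _ _ (level-adj (K 2) i λ ()) (trans eq′ (sym eq)))

isLeft : {A B : Set} → A ⊎ B → Bool
isLeft (inj₁ _) = true
isLeft (inj₂ _) = false

M₁-outColoring⇒bipartite : ∀ {G} → OutColoring (M 1 G) →
  ∃ λ (f : V G → Bool) → ∀ u v → Adj G u v → f u ≢ f v
M₁-outColoring⇒bipartite {G} C = isLeft ∘ apex , sides-differ
  where
  open OutColoring C using (adj⇒arc)

  apex : ∀ v → arc C (lvl v zero) z ⊎ arc C z (lvl v zero)
  -- With a single level, level 0 is also the top, so every `lvl v zero` is adjacent to `z`.
  apex v = adj⇒arc (lvl v zero) z refl

  no-arc : ∀ {u v} → arc C (lvl u zero) z → ¬ arc C (lvl u zero) (lvl v zero)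
  no-arc {u} {v} a b = proper C {lvl v zero} {z} refl (out-color C b a)

  sides-differ : ∀ u v → Adj G u v → isLeft (apex u) ≢ isLeft (apex v)
  sides-differ u v e eq with apex u | apex v | eq
  ... | inj₁ a | inj₁ b | _ = [ no-arc a , no-arc b ]′ (adj⇒arc _ _ (e , inj₂ (refl , refl)))
  ... | inj₂ a | inj₂ b | _ = proper C {lvl u zero} {lvl v zero} (e , inj₂ (refl , refl)) (out-color C a b)

-- Types of vertices and Mycielskians of graphs with a triangle

module _ {G : Graph} (C : OutColoring G) where
  open OutColoring C using (adj⇒arc) renaming (arc to _⟶_)

  -- The analogue of the vertex (a, b) of a shift graph. A vertex without out-neighbours has every
  -- `b` as its second entry.
  HasType : ℕ → ℕ → V G → Set
  HasType a b x = color C x ≡ a × (∀ {y} → x ⟶ y → color C y ≡ b)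

  arc⇒hasType : ∀ {x y} → x ⟶ y → HasType (color C x) (color C y) x
  arc⇒hasType a = refl , λ b → out-color C b a

  -- Only `x ⟶ y` with `w ⟶ x` survives: two arcs out of `x` force `b ≡ c`, two arcs into `x` force
  -- `a ≡ c`, and `y ⟶ x ⟶ w` gives `x` the color of its neighbour `w`.
  common-neighbour-type : ∀ {a b c x y w} → a ≢ c → b ≢ c → HasType b c y → HasType c a w →
    Adj G x y → Adj G x w → HasType a b x
  common-neighbour-type {x = x} {y} {w} a≢c b≢c (refl , y-out) (refl , w-out) xy xw
    with adj⇒arc x y xy | adj⇒arc x w xw
  ... | inj₁ p | inj₁ q = contradiction (out-color C p q) b≢c
  ... | inj₁ p | inj₂ q = w-out q , λ r → out-color C r p
  ... | inj₂ p | inj₁ q = contradiction (y-out p) (proper C xw)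
  ... | inj₂ p | inj₂ q = contradiction (trans (sym (w-out q)) (y-out p)) a≢c

  -- A non-cyclic triangle has a vertex with two out-arcs, whose heads are adjacent and yet share a
  -- color.
  triangle-cyclic : ∀ x y w → Adj G x y → Adj G y w → Adj G w x →
    (x ⟶ y × y ⟶ w × w ⟶ x) ⊎ (x ⟶ w × w ⟶ y × y ⟶ x)
  triangle-cyclic x y w xy yw wx with adj⇒arc x y xy | adj⇒arc y w yw | adj⇒arc w x wx
  ... | inj₁ p | inj₁ q | inj₁ r = inj₁ (p , q , r)
  ... | inj₂ p | inj₂ q | inj₂ r = inj₂ (r , q , p)
  ... | inj₁ p | _      | inj₂ r = contradiction (out-color C p r) (proper C yw)
  ... | inj₂ p | inj₁ q | _      = contradiction (out-color C q p) (proper C wx)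
  ... | _      | inj₂ q | inj₁ r = contradiction (out-color C r q) (proper C xy)

module _ {G : Graph} {r : ℕ} (C : OutColoring (M (suc r) G))
         {p q s : V G} (pq : Adj G p q) (qs : Adj G q s) (sp : Adj G s p) where
  open OutColoring C using (adj⇒arc) renaming (arc to _⟶_)

  private
    bottom : V G → V (M (suc r) G)
    bottom v = lvl v zero

    bottom-adj : ∀ {u v} → Adj G u v → Adj (M (suc r) G) (bottom u) (bottom v)
    bottom-adj e = e , inj₂ (refl , refl)

  cyclic-bottom-impossible : bottom p ⟶ bottom q → bottom q ⟶ bottom s → bottom s ⟶ bottom p → ⊥
  cyclic-bottom-impossible p⟶q q⟶s s⟶p = impossible (types (fromℕ r))
    where
    a b c : ℕ
    a = color C (bottom p)
    b = color C (bottom q)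
    c = color C (bottom s)

    a≢b = proper-arc C p⟶q
    b≢c = proper-arc C q⟶s
    c≢a = proper-arc C s⟶p

    up : ∀ {u v} i → Adj G u v → Adj (M (suc r) G) (lvl u (suc i)) (lvl v (inject₁ i))
    up {u} {v} i e = adj-sym (M (suc r) G) {lvl v (inject₁ i)} {lvl u (suc i)} (level-adj G i (adj-sym G e))

    -- On level `i + 1`, each vertex is adjacent to the level `i` copies of the other two triangle
    -- vertices, and their types determine its own.
    types : ∀ i → HasType C a b (lvl p i) × HasType C b c (lvl q i) × HasType C c a (lvl s i)
    types = <-weakInduction _
      (arc⇒hasType C p⟶q , arc⇒hasType C q⟶s , arc⇒hasType C s⟶p)
      λ { i (tp , tq , ts) →
          common-neighbour-type C (≢-sym c≢a) b≢c tq ts (up i pq) (up i (adj-sym G sp))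
        , common-neighbour-type C (≢-sym a≢b) c≢a ts tp (up i qs) (up i (adj-sym G pq))
        , common-neighbour-type C (≢-sym b≢c) a≢b tp tq (up i sp) (up i (adj-sym G qs)) }

    -- The opposite arc would give `z` the color `b`, which its neighbour `lvl v (fromℕ r)` already
    -- has.
    apex-out : ∀ {a b u v} → HasType C a b (lvl u (fromℕ r)) → color C (lvl v (fromℕ r)) ≡ b →
      z ⟶ lvl u (fromℕ r)
    apex-out {u = u} {v} (_ , out) v-color with adj⇒arc (lvl u (fromℕ r)) z (top-adj G u)
    ... | inj₁ e = contradiction (trans v-color (sym (out e))) (proper C {lvl v (fromℕ r)} {z} (top-adj G v))
    ... | inj₂ e = e

    impossible : HasType C a b (lvl p (fromℕ r)) × HasType C b c (lvl q (fromℕ r)) ×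
                 HasType C c a (lvl s (fromℕ r)) → ⊥
    impossible (tp , tq , ts) = a≢b
      (trans (sym (proj₁ tp)) (trans (out-color C (apex-out tp (proj₁ tq)) (apex-out tq (proj₁ ts))) (proj₁ tq)))

M-triangle-no-outColoring : ∀ {G r p q s} → Adj G p q → Adj G q s → Adj G s p → ¬ OutColoring (M (suc r) G)
M-triangle-no-outColoring {G} {r} {p} {q} {s} pq qs sp C
  with triangle-cyclic C (lvl p zero) (lvl q zero) (lvl s zero)
         (pq , inj₂ (refl , refl)) (qs , inj₂ (refl , refl)) (sp , inj₂ (refl , refl))
... | inj₁ (x , y , w) = cyclic-bottom-impossible C pq qs sp x y w
-- The reversed cycle is the first case with `q` and `s` exchanged.
... | inj₂ (x , y , w) = cyclic-bottom-impossible C (adj-sym G sp) (adj-sym G qs) (adj-sym G pq) x y w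

-- The two exceptional families and the conclusion

M₂-1-r-no-outColoring : ∀ r → ¬ OutColoring (M₂ 1 (suc r) (K 2))
M₂-1-r-no-outColoring r =
  -- `M 1 (K 2)` is itself a triangle: the two vertices of level 0 and the apex.
  M-triangle-no-outColoring {M 1 (K 2)} {p = lvl (# 0) zero} {lvl (# 1) zero} {z} ((λ ()) , inj₂ (refl , refl)) refl refl

M₂-r-1-no-outColoring : ∀ r → ¬ OutColoring (M₂ (suc r) 1 (K 2))
M₂-r-1-no-outColoring r C with M₁-outColoring⇒bipartite C
... | f , proper = M-K₂-not-bipartite r f proper

outColoring⇒2≤ : ∀ r₁ r₂ → 1 ≤ r₁ → 1 ≤ r₂ → OutColoring (M₂ r₁ r₂ (K 2)) → 2 ≤ r₁ × 2 ≤ r₂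
outColoring⇒2≤ (suc zero)     (suc r₂)        _ _ C = contradiction C (M₂-1-r-no-outColoring r₂)
outColoring⇒2≤ (suc (suc r₁)) (suc zero)      _ _ C = contradiction C (M₂-r-1-no-outColoring (suc r₁))
outColoring⇒2≤ (suc (suc _))  (suc (suc _))   _ _ _ = s≤s (s≤s z≤n) , s≤s (s≤s z≤n)

-- Supplies the edge required by `outColoring⇒ψd-min≡2`; positive indices guarantee that level 0
-- exists in both constructions.
M₂-edge : ∀ r₁ r₂ → 1 ≤ r₁ → 1 ≤ r₂ → ∃ λ u → ∃ λ v → Adj (M₂ r₁ r₂ (K 2)) u v
M₂-edge (suc r₁) (suc r₂) _ _ =
  lvl (lvl (# 0) zero) zero , lvl (lvl (# 1) zero) zero , ((λ ()) , inj₂ (refl , refl)) , inj₂ (refl , refl)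

mainTheorem7 : (∀ (r₁ r₂ : ℕ) → 1 ≤ r₁ → 1 ≤ r₂ →
    (ψd-min[ M₂ r₁ r₂ (K 2) ]≡ 2) ⇔ (2 ≤ r₁ × 2 ≤ r₂))
    × (∀ (r₁ r₂ : ℕ) → 2 ≤ r₁ → 2 ≤ r₂ → Hom (M₂ r₁ r₂ (K 2)) (S 4))
    × (∀ (r m : ℕ) → 1 ≤ r → 1 ≤ m →
    ¬ Hom (M₂ 1 r (K 2)) (S m) × ¬ Hom (M₂ r 1 (K 2)) (S m))
mainTheorem7 =
    (λ r₁ r₂ 1≤r₁ 1≤r₂ → mk⇔
      (outColoring⇒2≤ r₁ r₂ 1≤r₁ 1≤r₂ ∘ ψd-min≡2⇒outColoring (M₂-finite r₁ r₂))
      λ { (2≤r₁ , 2≤r₂) → case M₂-edge r₁ r₂ 1≤r₁ 1≤r₂ of λ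
          { (_ , _ , e) → outColoring⇒ψd-min≡2 (M₂-finite r₁ r₂) e
              (shift-hom⇒outColoring (M₂→S₄ r₁ r₂ 2≤r₁ 2≤r₂)) } })
  , M₂→S₄
  , λ { (suc r) m _ _ →
          M₂-1-r-no-outColoring r ∘ shift-hom⇒outColoring
        , M₂-r-1-no-outColoring r ∘ shift-hom⇒outColoring }
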